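{- For every positive integer $k$ there exist a constant $K_k>0$ and an integer $n_k$, both depending only on $k$, such that for every integer $n\ge n_k$ there exists a set of positive integers $A$ with $A\in C_k(n)$, $A\not\subseteq E_k(n)$ and $$|E_k(n)|-|A|\le K_k\,\frac{n}{\log\log n}.$$
   Context: Let $p_i$ denote the $i$th prime. For positive integers $k,n$: $C_k(n)$ is the family of all subsets $A\subseteq\{1,2,\ldots,n\}$ that do not contain $k+1$ (distinct) pairwise coprime integers; $E_k(n)$ is the set of positive integers not exceeding $n$ that are divisible by at least one of $p_1,\ldots,p_k$; $|A|$ denotes the number of elements of $A$. -}

module Defs where

open import Algebra.Definitions.RawSemiring using (_^_)
open import Data.Fin using (Fin; toℕ)
open import Data.Fin.Properties using (any?)
open import Data.Fin.Subset using (Subset; _∈_; _⊆_; ∣_∣)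
open import Data.List using ([]; _∷_)
open import Data.List.Relation.Unary.All using (_∷_)
open import Data.Nat as ℕ using (ℕ; zero; suc; s≤s; _!)
import Data.Nat.Properties as ℕ
open import Data.Nat.Coprimality using (Coprime)
open import Data.Nat.Divisibility
  using (_∣_; _∣?_; ∣-trans; m∣m*n; m≤n⇒m!∣n!; ∣m+n∣m⇒∣n; ∣1⇒≡1)
open import Data.Nat.Primality
  using (Prime; prime?; prime⇒nonZero; prime⇒nonTrivial)
open import Data.Nat.Primality.Factorisation using (factorise; module PrimeFactorisation)
open import Data.Integer as ℤ using (ℤ)
open import Data.Product using (∃-syntax; _×_; _,_; proj₁)
open import Data.Rational as ℚ using (ℚ; 0ℚ; 1ℚ; _+_; _*_; _<_; -_; _/_; +-*-rawSemiring)
open import Data.Vec using (tabulate)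
open import Relation.Binary.PropositionalEquality using (_≡_; _≢_; refl; sym; trans; subst)
open import Relation.Nullary using (¬_; Dec; does; yes; no; contradiction)

------------------------------------------------------------------------
-- The sequence of primes

private
  primeAbove : ∀ n → ∃[ p ] n ℕ.< p × Prime p
  primeAbove n with factorise (suc (n !))
  ... | record { factors = [] ; isFactorisation = eq } =
    contradiction (ℕ.suc-injective eq) (ℕ.m<n⇒n≢0 (ℕ.1≤n! n))
  ... | record { factors = p ∷ ps ; isFactorisation = eq ; factorsPrime = pp ∷ _ } =
    p , ℕ.≰⇒> p≰n , pp
    where
    m∣m! : ∀ m → .{{ℕ.NonZero m}} → m ∣ m !
    m∣m! (suc m) = m∣m*n (m !)

    p∣ : p ∣ n ! ℕ.+ 1
    p∣ = subst (p ∣_) (trans (sym eq) (ℕ.+-comm 1 (n !))) (m∣m*n _)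

    p≰n : ¬ (p ℕ.≤ n)
    p≰n p≤n = ℕ.nonTrivial⇒≢1 {{prime⇒nonTrivial pp}}
      (∣1⇒≡1 (∣m+n∣m⇒∣n p∣ (∣-trans (m∣m! p {{prime⇒nonZero pp}}) (m≤n⇒m!∣n! p≤n))))

IsNextPrime : ℕ → ℕ → Set
IsNextPrime n p = n ℕ.< p × Prime p × (∀ {q} → n ℕ.< q → q ℕ.< p → ¬ Prime q)

nextPrime : ∀ n → ∃[ p ] IsNextPrime n p
nextPrime n with primeAbove n
... | p , n<p , pp = search (p ℕ.∸ suc n) (suc n) ℕ.≤-refl
        (subst Prime (sym (ℕ.m∸n+n≡m n<p)) pp)
        (λ n<q q<1+n → contradiction (ℕ.≤-pred q<1+n) (ℕ.<⇒≱ n<q))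
  where
  search : ∀ d m → n ℕ.< m → Prime (d ℕ.+ m) →
           (∀ {q} → n ℕ.< q → q ℕ.< m → ¬ Prime q) → ∃[ p ] IsNextPrime n p
  search zero    m n<m mp none = m , n<m , mp , none
  search (suc d) m n<m dp none with prime? m
  ... | yes mp = m , n<m , mp , none
  ... | no ¬mp = search d (suc m) (ℕ.m<n⇒m<1+n n<m)
                   (subst Prime (sym (ℕ.+-suc d m)) dp) none′
    where
    none′ : ∀ {q} → n ℕ.< q → q ℕ.< suc m → ¬ Prime q
    none′ {q} n<q q<1+m qp with q ℕ.≟ m
    ... | yes refl = ¬mp qp
    ... | no  q≢m  = none n<q (ℕ.≤∧≢⇒< (ℕ.≤-pred q<1+m) q≢m) qp

-- nthPrime i is pᵢ for i ≥ 1 (p₁ = 2); the value at 0 is only a starting point.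
nthPrime : ℕ → ℕ
nthPrime zero    = 0
nthPrime (suc i) = proj₁ (nextPrime (nthPrime i))

------------------------------------------------------------------------
-- Subsets of {1,…,n}: the index i : Fin n stands for the integer 1 + i.

val : ∀ {n} → Fin n → ℕ
val i = suc (toℕ i)

PairwiseCoprime : ∀ {n} → Subset n → Set
PairwiseCoprime B = ∀ {i j} → i ∈ B → j ∈ B → i ≢ j → Coprime (val i) (val j)

C : ∀ k n → Subset n → Set
C k n A = ¬ (∃[ B ] B ⊆ A × ∣ B ∣ ≡ suc k × PairwiseCoprime B)

DivisibleByFirst : ℕ → ℕ → Set
DivisibleByFirst k m = ∃[ i ] nthPrime (val {k} i) ∣ m

divisibleByFirst? : ∀ k m → Dec (DivisibleByFirst k m)
divisibleByFirst? k m = any? (λ i → nthPrime (val i) ∣? m)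

E : ∀ k n → Subset n
E k n = tabulate (λ i → does (divisibleByFirst? k (val i)))

------------------------------------------------------------------------
-- Real numbers as Dedekind cuts, given by the rationals below and above.
-- No cut axioms are imposed, so log is total: log x = -∞ for x ≤ 0.

record Cut : Set₁ where
  field
    Lower Upper : ℚ → Set

open Cut public

infix 4 _≤ᶜ_
_≤ᶜ_ : Cut → Cut → Set
x ≤ᶜ y = ∀ {q} → Lower x q → Lower y q

fromℚ : ℚ → Cut
fromℚ x = record { Lower = λ q → q < x ; Upper = λ q → x < q }

fromℤ : ℤ → ℚ
fromℤ z = z / 1

fromℕ : ℕ → ℚ
fromℕ n = fromℤ (ℤ.+ n)

-- e^q is the supremum of (1 + q/N)^N over the N ≥ 1 with 1 + q/N > 0, along
-- which (1 + q/N)^N increases.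

compoundBase : ℚ → ℕ → ℚ
compoundBase q m = 1ℚ + q * (ℤ.+ 1 / suc m)

compound : ℚ → ℕ → ℚ
compound q m = _^_ +-*-rawSemiring (compoundBase q m) (suc m)

_<exp_ : ℚ → ℚ → Set
r <exp q = ∃[ m ] 0ℚ < compoundBase q m × r < compound q m

-- e^q < r  ⇔  1 < r e^(-q)
exp_<_ : ℚ → ℚ → Set
exp q < r = ∃[ m ] 0ℚ < compoundBase (- q) m × 1ℚ < r * compound (- q) m

-- The natural logarithm: q < log x ⇔ e^q < x, and log x < q ⇔ x < e^q.
log : Cut → Cut
log x = record
  { Lower = λ q → ∃[ r ] exp q < r × Lower x r
  ; Upper = λ q → ∃[ r ] Upper x r × r <exp q
  }

-- The quotient c / y, for c > 0 and y > 0.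
infixl 7 _÷ᶜ_
_÷ᶜ_ : ℚ → Cut → Cut
c ÷ᶜ y = record
  { Lower = λ q → ∃[ u ] Upper y u × q * u < c
  ; Upper = λ q → ∃[ l ] 0ℚ < l × Lower y l × c < q * l
  }

{-# OPTIONS --safe #-}

-- Let Q = p₁⋯p_k and let m be the product of the numbers 1 + iQ for i < 2ᵗ.
-- Take A to consist of the multiples of p₁, …, p_{k-1}, the multiples of p_k
-- that are not coprime to m, and m itself.  The last two groups contribute at
-- most one element to a pairwise coprime subset, so A ∈ C_k(n), while m ≡ 1
-- modulo Q is not in E_k(n).  At most the x ≤ n coprime to m are lost.
--
-- Instead of Mertens' theorem: the sets (1 + iQ) · {s : s coprime to m}, i < 2ᵗ,
-- are pairwise disjoint, since 1 + iQ divides m.  Comparing densities,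
-- φ(m)/m · Σ 1/(1 + iQ) ≤ 1, and the sum is at least t/(2Q).
-- As m ≤ 2^(2^(2t+1)), t can be taken of order log log n.

module Submission where

open import Defs

-- Finite sums and products, and counting by indicator functions.

module Summation where

  open import Data.Bool using (true; false; if_then_else_)
  open import Data.Fin using (toℕ)
  open import Data.Fin.Subset using (∣_∣)
  open import Data.List using (applyUpTo)
  open import Data.List.Membership.Propositional.Properties using (∈-applyUpTo⁺)
  open import Data.Nat
  open import Data.Nat.Divisibility using (_∣_)
  open import Data.Nat.ListAction using (sum; product)
  open import Data.Nat.ListAction.Properties using (∈⇒∣product)
  open import Data.Nat.Properties
  open import Data.Nat.Tactic.RingSolver using (solve-∀)
  open import Data.Product using (∃-syntax; _,_)
  open import Data.Sum using (_⊎_; inj₁; inj₂)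
  open import Data.Vec using (tabulate)
  open import Function using (_∘_)
  open import Relation.Binary.PropositionalEquality
  open import Relation.Nullary using (Dec; does; yes; no; contradiction)

  ∑ ∏ : ℕ → (ℕ → ℕ) → ℕ
  ∑ n f = sum (applyUpTo f n)
  ∏ n f = product (applyUpTo f n)

  ∑-mono-≤ : ∀ n {f g} → (∀ {i} → i < n → f i ≤ g i) → ∑ n f ≤ ∑ n g
  ∑-mono-≤ zero    f≤g = z≤n
  ∑-mono-≤ (suc n) f≤g = +-mono-≤ (f≤g z<s) (∑-mono-≤ n (f≤g ∘ s<s))

  ∑-cong : ∀ n {f g} → (∀ i → f i ≡ g i) → ∑ n f ≡ ∑ n g
  ∑-cong zero    f≡g = refl
  ∑-cong (suc n) f≡g = cong₂ _+_ (f≡g 0) (∑-cong n (f≡g ∘ suc))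

  ∑-const : ∀ n c → ∑ n (λ _ → c) ≡ n * c
  ∑-const zero    c = refl
  ∑-const (suc n) c = cong (c +_) (∑-const n c)

  ∑-split : ∀ m {n} f → ∑ (m + n) f ≡ ∑ m f + ∑ n (f ∘ (m +_))
  ∑-split zero    f = refl
  ∑-split (suc m) f =
    trans (cong (f 0 +_) (∑-split m (f ∘ suc))) (sym (+-assoc (f 0) _ _))

  ∑-monoˡ-≤ : ∀ {m n} f → m ≤ n → ∑ m f ≤ ∑ n f
  ∑-monoˡ-≤ {m} {n} f m≤n = begin
    ∑ m f                               ≤⟨ m≤m+n _ _ ⟩
    ∑ m f + ∑ (n ∸ m) (f ∘ (m +_))      ≡⟨ ∑-split m f ⟨
    ∑ (m + (n ∸ m)) f                   ≡⟨ cong (λ l → ∑ l f) (m+[n∸m]≡n m≤n) ⟩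
    ∑ n f                               ∎
    where open ≤-Reasoning

  ∑-distrib-+ : ∀ n f g → ∑ n (λ i → f i + g i) ≡ ∑ n f + ∑ n g
  ∑-distrib-+ zero    f g = refl
  ∑-distrib-+ (suc n) f g =
    trans (cong (f 0 + g 0 +_) (∑-distrib-+ n (f ∘ suc) (g ∘ suc)))
          (interchange (f 0) (g 0) _ _)
    where
    interchange : ∀ a b c d → a + b + (c + d) ≡ a + c + (b + d)
    interchange = solve-∀

  ∑-comm : ∀ m n (f : ℕ → ℕ → ℕ) → ∑ m (λ i → ∑ n (f i)) ≡ ∑ n (λ j → ∑ m (λ i → f i j))
  ∑-comm zero    n f = sym (trans (∑-const n 0) (*-zeroʳ n))
  ∑-comm (suc m) n f =
    trans (cong (∑ n (f 0) +_) (∑-comm m n (f ∘ suc)))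
          (sym (∑-distrib-+ n (f 0) _))

  ∑-*ʳ : ∀ n f c → ∑ n f * c ≡ ∑ n (λ i → f i * c)
  ∑-*ʳ zero    f c = refl
  ∑-*ʳ (suc n) f c =
    trans (*-distribʳ-+ c (f 0) _) (cong (f 0 * c +_) (∑-*ʳ n (f ∘ suc) c))

  ∑-periodic : ∀ c m f → (∀ x → f (m + x) ≡ f x) → ∑ (c * m) f ≡ c * ∑ m f
  ∑-periodic zero    m f per = refl
  ∑-periodic (suc c) m f per = trans (∑-split m f)
    (cong (∑ m f +_) (trans (∑-cong (c * m) per) (∑-periodic c m f per)))

  -- Each multiple of `a` opens a block of `a` consecutive indices, and dropping the rest of the
  -- block only lowers the sum.
  ∑-multiples : ∀ n a .{{_ : NonZero a}} f → ∑ n (λ s → f (s * a)) ≤ ∑ (n * a) f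
  ∑-multiples zero    a         f = z≤n
  ∑-multiples (suc n) a@(suc _) f = begin
    f 0 + ∑ n (λ s → f (a + s * a))    ≤⟨ +-mono-≤ (m≤m+n (f 0) _) (∑-multiples n a (f ∘ (a +_))) ⟩
    ∑ a f + ∑ (n * a) (f ∘ (a +_))     ≡⟨ ∑-split a f ⟨
    ∑ (a + n * a) f                    ∎
    where open ≤-Reasoning

  ∣∏ : ∀ {n i} f → i < n → f i ∣ ∏ n f
  ∣∏ f i<n = ∈⇒∣product (∈-applyUpTo⁺ f i<n)

  ∏≤^ : ∀ n {f b} → (∀ {i} → i < n → f i ≤ b) → ∏ n f ≤ b ^ n
  ∏≤^ zero    f≤b = ≤-refl
  ∏≤^ (suc n) f≤b = *-mono-≤ (f≤b z<s) (∏≤^ n (f≤b ∘ s<s))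

  ∏≢0 : ∀ n {f} → (∀ i → NonZero (f i)) → NonZero (∏ n f)
  ∏≢0 zero        f≢0 = _
  ∏≢0 (suc n) {f} f≢0 = m*n≢0 (f 0) _ {{f≢0 0}} {{∏≢0 n (f≢0 ∘ suc)}}

  -- Residue 1 modulo `q` is closed under multiplication; the witness `w` expresses the congruence
  -- without subtraction.
  ∏≡1 : ∀ q n {f} → (∀ i → ∃[ w ] f i ≡ suc (w * q)) → ∃[ w ] ∏ n f ≡ suc (w * q)
  ∏≡1 q zero    f≡1 = 0 , refl
  ∏≡1 q (suc n) f≡1 with v , f₀≡ ← f≡1 0 | w , ∏≡ ← ∏≡1 q n (f≡1 ∘ suc) =
    v + w + v * w * q , trans (cong₂ _*_ f₀≡ ∏≡) (expand q v w)
    where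
    expand : ∀ q v w → suc (v * q) * suc (w * q) ≡ suc ((v + w + v * w * q) * q)
    expand = solve-∀

  𝟙 : {P : Set} → Dec P → ℕ
  𝟙 P? = if does P? then 1 else 0

  𝟙-mono-≤ : {P Q : Set} (P? : Dec P) (Q? : Dec Q) → (P → Q) → 𝟙 P? ≤ 𝟙 Q?
  𝟙-mono-≤ (no _)  _       _   = z≤n
  𝟙-mono-≤ (yes _) (yes _) _   = ≤-refl
  𝟙-mono-≤ (yes p) (no ¬q) P⇒Q = contradiction (P⇒Q p) ¬q

  𝟙-⊎ : {P Q R : Set} (P? : Dec P) (Q? : Dec Q) (R? : Dec R) →
        (P → Q ⊎ R) → 𝟙 P? ≤ 𝟙 Q? + 𝟙 R?
  𝟙-⊎ (no _)  _       _       _    = z≤n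
  𝟙-⊎ (yes _) (yes _) _       _    = s≤s z≤n
  𝟙-⊎ (yes _) (no _)  (yes _) _    = ≤-refl
  𝟙-⊎ (yes p) (no ¬q) (no ¬r) P⇒Q⊎R with P⇒Q⊎R p
  ... | inj₁ q = contradiction q ¬q
  ... | inj₂ r = contradiction r ¬r

  -- Turns disjointness of a family of sets into a bound on how often one point is covered.
  ∑-unique : ∀ n {P : ℕ → Set} (P? : ∀ i → Dec (P i)) →
             (∀ {i j} → i < n → j < n → P i → P j → i ≡ j) → ∑ n (λ i → 𝟙 (P? i)) ≤ 1
  ∑-unique zero    P? unique = z≤n
  ∑-unique (suc n) P? unique with P? 0
  ... | no  _  = ∑-unique n (P? ∘ suc)
                   (λ i<n j<n pi pj → suc-injective (unique (s<s i<n) (s<s j<n) pi pj))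
  ... | yes p₀ = s≤s (≤-trans (∑-mono-≤ n none) (≤-reflexive (trans (∑-const n 0) (*-zeroʳ n))))
    where
    none : ∀ {i} → i < n → 𝟙 (P? (suc i)) ≤ 0
    none {i} i<n with P? (suc i)
    ... | no _  = z≤n
    ... | yes p = contradiction (unique z<s (s<s i<n) p₀ p) λ ()

  ∣tabulate∣ : ∀ n {P : ℕ → Set} (P? : ∀ x → Dec (P x)) →
               ∣ tabulate {n = n} (λ i → does (P? (toℕ i))) ∣ ≡ ∑ n (λ x → 𝟙 (P? x))
  ∣tabulate∣ zero    P? = refl
  ∣tabulate∣ (suc n) P? with does (P? 0)
  ... | true  = cong suc (∣tabulate∣ n (P? ∘ suc))
  ... | false = ∣tabulate∣ n (P? ∘ suc)

-- Integers coprime to m, and the upper bound for φ(m)/m.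

module Sieve where

  open Summation
  open import Data.Nat
  open import Data.Nat.Coprimality using (Coprime; coprime?; coprime-+; coprime-divisor)
  open import Data.Nat.Divisibility
  open import Data.Nat.DivMod
  open import Data.Nat.Properties
  open import Data.Nat.Tactic.RingSolver using (solve-∀)
  open import Data.Product using (∃-syntax; _×_; _,_)
  open import Function using (_∘_)
  open import Relation.Binary.PropositionalEquality
  open import Relation.Nullary using (yes; no; contradiction; Dec)
  open import Relation.Nullary.Decidable using (_×-dec_)

  n<2^n : ∀ n → n < 2 ^ n
  n<2^n zero    = z<s
  n<2^n (suc n) = begin-strict
    suc n              <⟨ s<s (n<2^n n) ⟩
    1 + 2 ^ n          ≤⟨ +-monoˡ-≤ (2 ^ n) (m^n>0 2 n) ⟩
    2 ^ n + 2 ^ n      ≡⟨ cong (2 ^ n +_) (+-identityʳ (2 ^ n)) ⟨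
    2 ^ suc n          ∎
    where open ≤-Reasoning

  coprimeTo : ℕ → ℕ → ℕ
  coprimeTo m s = 𝟙 (coprime? s m)

  coprimeTo-periodic : ∀ m s → coprimeTo m (m + s) ≡ coprimeTo m s
  coprimeTo-periodic m s = ≤-antisym
    (𝟙-mono-≤ (coprime? (m + s) m) (coprime? s m)
      (λ c (d∣s , d∣m) → c (∣m∣n⇒∣m+n d∣m d∣s , d∣m)))
    (𝟙-mono-≤ (coprime? s m) (coprime? (m + s) m) coprime-+)

  -- Euler's totient, counted over 0, ..., m - 1 so that the range is a period starting at 0.
  φ : ℕ → ℕ
  φ m = ∑ m (coprimeTo m)

  -- The integers from 0 to n are covered by ⌊n/m⌋ + 1 periods, each with φ(m) integers coprime to
  -- m; their total length is at most n + m ≤ 2n.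
  ∑-coprimeTo : ∀ m .{{_ : NonZero m}} n → m ≤ n →
                ∑ n (coprimeTo m ∘ suc) * m ≤ 2 * n * φ m
  ∑-coprimeTo m n m≤n = begin
    ∑ n (coprimeTo m ∘ suc) * m          ≤⟨ *-monoˡ-≤ m (m≤n+m _ (coprimeTo m 0)) ⟩
    ∑ (suc n) (coprimeTo m) * m          ≤⟨ *-monoˡ-≤ m (∑-monoˡ-≤ (coprimeTo m) n<blocks) ⟩
    ∑ (suc (n / m) * m) (coprimeTo m) * m ≡⟨ cong (_* m) (∑-periodic (suc (n / m)) m _ (coprimeTo-periodic m)) ⟩
    suc (n / m) * φ m * m                ≡⟨ swap (suc (n / m)) (φ m) m ⟩
    (m + n / m * m) * φ m                ≤⟨ *-monoˡ-≤ (φ m) (+-mono-≤ m≤n (m/n*n≤m n m)) ⟩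
    (n + n) * φ m                        ≡⟨ cong (λ l → (n + l) * φ m) (+-identityʳ n) ⟨
    2 * n * φ m                          ∎
    where
    open ≤-Reasoning
    n<blocks : n < suc (n / m) * m
    n<blocks = begin-strict
      n                       ≡⟨ m≡m%n+[m/n]*n n m ⟩
      n % m + n / m * m       <⟨ +-monoˡ-< _ (m%n<n n m) ⟩
      suc (n / m) * m         ∎
    swap : ∀ a b c → a * b * c ≡ a * c * b
    swap = solve-∀

  term : ℕ → ℕ → ℕ
  term Q i = suc (i * Q)

  term≤ : ∀ Q .{{_ : NonZero Q}} {i n} → i < n → term Q i ≤ n * Q
  term≤ Q {i} i<n = ≤-trans (+-monoˡ-≤ (i * Q) (>-nonZero⁻¹ Q)) (*-monoˡ-≤ Q i<n)

  -- The lower bound Σ 1/(1 + iQ) ≥ t/(2Q) over i < 2ᵗ, cleared of denominators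
  -- by c i = m/(1 + iQ).
  harmonic : ∀ Q .{{_ : NonZero Q}} m t (c : ℕ → ℕ) →
             (∀ {i} → i < 2 ^ t → m ≤ c i * term Q i) → t * m ≤ ∑ (2 ^ t) c * (2 * Q)
  harmonic Q m zero    c m≤ = z≤n
  harmonic Q m (suc t) c m≤ rewrite +-identityʳ (2 ^ t) = begin
    m + t * m                                 ≤⟨ +-mono-≤ block (harmonic Q m t c (m≤ ∘ λ i<L → <-≤-trans i<L (m≤m+n L L))) ⟩
    ∑ L c′ * (2 * Q) + ∑ L c * (2 * Q)        ≡⟨ *-distribʳ-+ (2 * Q) (∑ L c′) (∑ L c) ⟨
    (∑ L c′ + ∑ L c) * (2 * Q)                ≡⟨ cong (_* (2 * Q)) (+-comm (∑ L c′) (∑ L c)) ⟩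
    (∑ L c + ∑ L c′) * (2 * Q)                ≡⟨ cong (_* (2 * Q)) (∑-split L c) ⟨
    ∑ (L + L) c * (2 * Q)                     ∎
    where
    open ≤-Reasoning
    L = 2 ^ t
    c′ = c ∘ (L +_)
    instance L≢0 = m^n≢0 2 t

    reorder : ∀ s L Q → s * ((L + L) * Q) ≡ L * (s * (2 * Q))
    reorder = solve-∀

    -- On the dyadic block L ≤ i < 2L each of the L terms 1 + iQ is at most 2LQ, so their
    -- reciprocals add up to at least 1/(2Q).
    block : m ≤ ∑ L c′ * (2 * Q)
    block = *-cancelˡ-≤ L (begin
      L * m                                   ≡⟨ ∑-const L m ⟨
      ∑ L (λ _ → m)                           ≤⟨ ∑-mono-≤ L (λ {j} j<L → ≤-trans (m≤ (+-monoʳ-< L j<L))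
                                                    (*-monoʳ-≤ (c′ j) (term≤ Q (+-monoʳ-< L j<L)))) ⟩
      ∑ L (λ j → c′ j * ((L + L) * Q))        ≡⟨ ∑-*ʳ L c′ _ ⟨
      ∑ L c′ * ((L + L) * Q)                  ≡⟨ reorder (∑ L c′) L Q ⟩
      L * (∑ L c′ * (2 * Q))                  ∎)

  module _ (Q : ℕ) .{{_ : NonZero Q}} where

    modulus : ℕ → ℕ
    modulus t = ∏ (2 ^ t) (term Q)

    modulus≡1 : ∀ t → ∃[ w ] modulus t ≡ suc (w * Q)
    modulus≡1 t = ∏≡1 Q (2 ^ t) (λ i → i , refl)

    modulus≢0 : ∀ t → NonZero (modulus t)
    modulus≢0 t with _ , eq ← modulus≡1 t = subst NonZero (sym eq) _

    -- As Q ≤ t ≤ 2ᵗ, each of the 2ᵗ factors is at most 4ᵗ, and the resulting exponent 2t · 2ᵗ is at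
    -- most 2 · 2ᵗ · 2ᵗ.
    modulus≤ : ∀ {t} → Q ≤ t → modulus t ≤ 2 ^ (2 ^ (1 + t + t))
    modulus≤ {t} Q≤t = begin
      modulus t                   ≤⟨ ∏≤^ L term≤2^ ⟩
      (2 ^ (t + t)) ^ L           ≡⟨ ^-*-assoc 2 (t + t) L ⟩
      2 ^ ((t + t) * L)           ≤⟨ ^-monoʳ-≤ 2 (*-monoˡ-≤ L (+-mono-≤ t≤L t≤L)) ⟩
      2 ^ ((L + L) * L)           ≡⟨ cong (2 ^_) (double L) ⟩
      2 ^ (2 * (L * L))           ≡⟨ cong (λ l → 2 ^ (2 * l)) (^-distribˡ-+-* 2 t t) ⟨
      2 ^ (2 ^ (1 + t + t))       ∎
      where
      open ≤-Reasoning
      L = 2 ^ t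
      t≤L = <⇒≤ (n<2^n t)

      double : ∀ l → (l + l) * l ≡ 2 * (l * l)
      double = solve-∀

      term≤2^ : ∀ {i} → i < L → term Q i ≤ 2 ^ (t + t)
      term≤2^ i<L = begin
        _               ≤⟨ term≤ Q i<L ⟩
        L * Q           ≤⟨ *-monoʳ-≤ L (≤-trans Q≤t t≤L) ⟩
        L * L           ≡⟨ ^-distribˡ-+-* 2 t t ⟨
        2 ^ (t + t)     ∎

    -- Densities are compared by counting on 0 ≤ x < m², which holds a whole number of periods of
    -- each dilated set: `disjoint` bounds φ(m) · Σ m/(1 + iQ) by m², and `harmonic` bounds the sum
    -- from below.
    φ-modulus : ∀ t → t * φ (modulus t) ≤ modulus t * (2 * Q)
    φ-modulus t = *-cancelˡ-≤ m (begin
      m * (t * φ m)               ≡⟨ swap m t (φ m) ⟩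
      t * m * φ m                 ≤⟨ *-monoˡ-≤ (φ m) (harmonic Q m t c (≤-reflexive ∘ sym ∘ c*term)) ⟩
      ∑ Y c * (2 * Q) * φ m       ≡⟨ swap′ (∑ Y c) (2 * Q) (φ m) ⟩
      ∑ Y c * φ m * (2 * Q)       ≤⟨ *-monoˡ-≤ (2 * Q) disjoint ⟩
      m * m * (2 * Q)             ≡⟨ *-assoc m m _ ⟩
      m * (m * (2 * Q))           ∎)
      where
      open ≤-Reasoning
      Y = 2 ^ t
      m = modulus t
      a = term Q
      instance m≢0 = modulus≢0 t

      c : ℕ → ℕ
      c i = m / a i

      swap : ∀ x y z → x * (y * z) ≡ y * x * z
      swap = solve-∀

      swap′ : ∀ x y z → x * y * z ≡ x * z * y
      swap′ = solve-∀

      c*term : ∀ {i} → i < Y → c i * a i ≡ m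
      c*term i<Y = m/n*n≡m (∣∏ a i<Y)

      -- Membership of `x` in (1 + iQ) · {s : s coprime to m}, put as a condition on the quotient so
      -- that it is directly decidable.
      Scaled : ℕ → ℕ → Set
      Scaled x i = a i ∣ x × Coprime (x / a i) m

      scaled? : ∀ x i → Dec (Scaled x i)
      scaled? x i = (a i ∣? x) ×-dec coprime? (x / a i) m

      -- `a i` divides m, hence is coprime to x / a j; since it divides x = (x / a j) · a j, it
      -- divides `a j`.
      term-∣ : ∀ {x i j} → i < Y → Scaled x i → Scaled x j → a i ∣ a j
      term-∣ {x} {i} {j} i<Y (aᵢ∣x , _) (aⱼ∣x , coprime) =
        coprime-divisor
          (λ (d∣aᵢ , d∣x/aⱼ) → coprime (d∣x/aⱼ , ∣-trans d∣aᵢ (∣∏ a i<Y)))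
          (subst (a i ∣_) (sym (m/n*n≡m aⱼ∣x)) aᵢ∣x)

      scaled-unique : ∀ {x i j} → i < Y → j < Y → Scaled x i → Scaled x j → i ≡ j
      scaled-unique {x} {i} {j} i<Y j<Y sᵢ sⱼ = *-cancelʳ-≡ i j Q
        (suc-injective (∣-antisym (term-∣ {x} {i} {j} i<Y sᵢ sⱼ) (term-∣ {x} {j} {i} j<Y sⱼ sᵢ)))

      -- The s below c i · m fill `c i` periods and yield elements s · a i below c i · m · a i = m².
      scale : ∀ {i} → i < Y → c i * φ m ≤ ∑ (m * m) (λ x → 𝟙 (scaled? x i))
      scale {i} i<Y = begin
        c i * φ m                                    ≡⟨ ∑-periodic (c i) m _ (coprimeTo-periodic m) ⟨
        ∑ (c i * m) (coprimeTo m)                    ≤⟨ ∑-mono-≤ (c i * m) (λ {s} _ →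
                                                          𝟙-mono-≤ (coprime? s m) (scaled? (s * a i) i) (λ coprime →
                                                            n∣m*n s , subst (λ s′ → Coprime s′ m) (sym (m*n/n≡m s (a i))) coprime)) ⟩
        ∑ (c i * m) (λ s → 𝟙 (scaled? (s * a i) i))  ≤⟨ ∑-multiples (c i * m) (a i) (λ x → 𝟙 (scaled? x i)) ⟩
        ∑ (c i * m * a i) (λ x → 𝟙 (scaled? x i))    ≡⟨ cong (λ l → ∑ l (λ x → 𝟙 (scaled? x i)))
                                                          (trans (swap′ (c i) m (a i)) (cong (_* m) (c*term i<Y))) ⟩
        ∑ (m * m) (λ x → 𝟙 (scaled? x i))            ∎

      disjoint : ∑ Y c * φ m ≤ m * m
      disjoint = begin
        ∑ Y c * φ m                                       ≡⟨ ∑-*ʳ Y c (φ m) ⟩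
        ∑ Y (λ i → c i * φ m)                             ≤⟨ ∑-mono-≤ Y scale ⟩
        ∑ Y (λ i → ∑ (m * m) (λ x → 𝟙 (scaled? x i)))     ≡⟨ ∑-comm Y (m * m) (λ i x → 𝟙 (scaled? x i)) ⟩
        ∑ (m * m) (λ x → ∑ Y (λ i → 𝟙 (scaled? x i)))     ≤⟨ ∑-mono-≤ (m * m) (λ {x} _ → ∑-unique Y (scaled? x) (scaled-unique {x})) ⟩
        ∑ (m * m) (λ _ → 1)                               ≡⟨ trans (∑-const (m * m) 1) (*-identityʳ (m * m)) ⟩
        m * m                                             ∎

    -- By t ≥ 1, 4 + 2t ≤ 6t. The constant is 6 · 2 · 2Q, with 2 from `∑-coprimeTo` and 2Q from
    -- `φ-modulus`; the factor 4 + 2t will bound log log n.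
    lost≤ : ∀ {t n} → 1 ≤ t → modulus t ≤ n →
            ∑ n (coprimeTo (modulus t) ∘ suc) * (4 + t + t) ≤ 24 * Q * n
    lost≤ {t} {n} 1≤t m≤n = *-cancelʳ-≤ _ _ m (begin
      f * (4 + t + t) * m           ≤⟨ *-monoˡ-≤ m (*-monoʳ-≤ f (+-monoˡ-≤ t (+-monoˡ-≤ t (*-monoʳ-≤ 4 1≤t)))) ⟩
      f * (4 * t + t + t) * m       ≡⟨ reorder f t m ⟩
      6 * t * (f * m)               ≤⟨ *-monoʳ-≤ (6 * t) (∑-coprimeTo m n m≤n) ⟩
      6 * t * (2 * n * φ m)         ≡⟨ reorder′ t n (φ m) ⟩
      12 * n * (t * φ m)            ≤⟨ *-monoʳ-≤ (12 * n) (φ-modulus t) ⟩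
      12 * n * (m * (2 * Q))        ≡⟨ reorder″ n m Q ⟩
      24 * Q * n * m                ∎)
      where
      open ≤-Reasoning
      m = modulus t
      instance m≢0 = modulus≢0 t
      f = ∑ n (coprimeTo m ∘ suc)

      reorder : ∀ f t m → f * (4 * t + t + t) * m ≡ 6 * t * (f * m)
      reorder = solve-∀

      reorder′ : ∀ t n p → 6 * t * (2 * n * p) ≡ 12 * n * (t * p)
      reorder′ = solve-∀

      reorder″ : ∀ n m q → 12 * n * (m * (2 * q)) ≡ 24 * q * n * m
      reorder″ = solve-∀

  -- The search climbs from `t₀` until f (t + 1) exceeds n. Fuel n suffices, since t < f t ≤ n keeps
  -- t below n.
  bracket : ∀ (f : ℕ → ℕ) → (∀ t → t < f t) → ∀ {t₀ n} → f t₀ ≤ n →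
            ∃[ t ] t₀ ≤ t × f t ≤ n × n < f (suc t)
  bracket f t<f {t₀} {n} = search n t₀ (m≤m+n n t₀)
    where
    search : ∀ d t → n ≤ d + t → f t ≤ n → ∃[ t′ ] t ≤ t′ × f t′ ≤ n × n < f (suc t′)
    search zero    t n≤t ft≤n = contradiction (<-≤-trans (t<f t) ft≤n) (≤⇒≯ n≤t)
    search (suc d) t n≤  ft≤n with f (suc t) ≤? n
    ... | no  f≰n = t , ≤-refl , ft≤n , ≰⇒> f≰n
    ... | yes f≤n with t′ , t<t′ , bounds ← search d (suc t) (subst (n ≤_) (sym (+-suc d t)) n≤) f≤n
      = t′ , <⇒≤ t<t′ , bounds

-- Upper bounds for log log n in terms of powers of 2.

module LogLog where

  open import Algebra.Definitions.RawSemiring using (_^_)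
  import Data.Integer as ℤ
  import Data.Integer.Properties as ℤ
  open import Data.Nat as ℕ using (zero; suc)
  import Data.Nat.Properties as ℕ
  open import Data.Product using (_,_)
  open import Data.Rational
  open import Data.Rational.Properties
  open import Data.Rational.Unnormalised as ℚᵘ using (mkℚᵘ)
  import Data.Rational.Unnormalised.Properties as ℚᵘ
  open import Relation.Binary.PropositionalEquality

  -- Passing to the unnormalised fraction z/1 sidesteps reduction to lowest terms in the lemmas on
  -- products and order.
  fromℤ-≃ : ∀ z → toℚᵘ (fromℤ z) ℚᵘ.≃ mkℚᵘ z 0
  fromℤ-≃ z = toℚᵘ-fromℚᵘ (mkℚᵘ z 0)

  fromℤ-* : ∀ a b → fromℤ (a ℤ.* b) ≡ fromℤ a * fromℤ b
  fromℤ-* a b = toℚᵘ-injective (begin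
    toℚᵘ (fromℤ (a ℤ.* b))                ≈⟨ fromℤ-≃ (a ℤ.* b) ⟩
    mkℚᵘ a 0 ℚᵘ.* mkℚᵘ b 0                ≈⟨ ℚᵘ.*-cong (fromℤ-≃ a) (fromℤ-≃ b) ⟨
    toℚᵘ (fromℤ a) ℚᵘ.* toℚᵘ (fromℤ b)    ≈⟨ toℚᵘ-homo-* (fromℤ a) (fromℤ b) ⟨
    toℚᵘ (fromℤ a * fromℤ b)              ∎)
    where open import Relation.Binary.Reasoning.Setoid ℚᵘ.≃-setoid

  fromℤ-mono-< : ∀ {a b} → a ℤ.< b → fromℤ a < fromℤ b
  fromℤ-mono-< {a} {b} a<b = toℚᵘ-cancel-<
    (ℚᵘ.<-respˡ-≃ (ℚᵘ.≃-sym (fromℤ-≃ a)) (ℚᵘ.<-respʳ-≃ (ℚᵘ.≃-sym (fromℤ-≃ b))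
      (ℚᵘ.*<* (ℤ.*-monoʳ-<-pos (ℤ.+ 1) a<b))))

  fromℤ-mono-≤ : ∀ {a b} → a ℤ.≤ b → fromℤ a ≤ fromℤ b
  fromℤ-mono-≤ {a} {b} a≤b = toℚᵘ-cancel-≤
    (ℚᵘ.≤-respˡ-≃ (ℚᵘ.≃-sym (fromℤ-≃ a)) (ℚᵘ.≤-respʳ-≃ (ℚᵘ.≃-sym (fromℤ-≃ b))
      (ℚᵘ.*≤* (ℤ.*-monoʳ-≤-nonNeg (ℤ.+ 1) a≤b))))

  fromℕ-* : ∀ a b → fromℕ (a ℕ.* b) ≡ fromℕ a * fromℕ b
  fromℕ-* a b = trans (cong fromℤ (ℤ.pos-* a b)) (fromℤ-* (ℤ.+ a) (ℤ.+ b))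

  fromℕ-mono-< : ∀ {a b} → a ℕ.< b → fromℕ a < fromℕ b
  fromℕ-mono-< a<b = fromℤ-mono-< (ℤ.+<+ a<b)

  fromℕ-2^ : ∀ n → _^_ +-*-rawSemiring (fromℕ 2) n ≡ fromℕ (2 ℕ.^ n)
  fromℕ-2^ zero    = refl
  fromℕ-2^ (suc n) = trans (cong (fromℕ 2 *_) (fromℕ-2^ n)) (sym (fromℕ-* 2 (2 ℕ.^ n)))

  compoundBase≡2 : ∀ r → compoundBase (fromℕ (suc r)) r ≡ fromℕ 2
  compoundBase≡2 r = cong (1ℚ +_) (toℚᵘ-injective {y = 1ℚ} (begin
    toℚᵘ (fromℕ (suc r) * (ℤ.+ 1 / suc r))            ≈⟨ toℚᵘ-homo-* (fromℕ (suc r)) (ℤ.+ 1 / suc r) ⟩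
    toℚᵘ (fromℕ (suc r)) ℚᵘ.* toℚᵘ (ℤ.+ 1 / suc r)    ≈⟨ ℚᵘ.*-cong (fromℤ-≃ (ℤ.+ suc r)) (toℚᵘ-fromℚᵘ (mkℚᵘ (ℤ.+ 1) r)) ⟩
    mkℚᵘ (ℤ.+ suc r) 0 ℚᵘ.* mkℚᵘ (ℤ.+ 1) r            ≈⟨ ℚᵘ.*-inverseʳ (mkℚᵘ (ℤ.+ suc r) 0) ⟩
    toℚᵘ 1ℚ                                           ∎))
    where open import Relation.Binary.Reasoning.Setoid ℚᵘ.≃-setoid

  compound≡2^ : ∀ r → compound (fromℕ (suc r)) r ≡ fromℕ (2 ℕ.^ suc r)
  compound≡2^ r =
    trans (cong (λ b → _^_ +-*-rawSemiring b (suc r)) (compoundBase≡2 r)) (fromℕ-2^ (suc r))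

  -- (1 + r/N)^N at N = r gives 2^r ≤ e^r.
  <2^⇒<exp : ∀ r {x} → x < fromℕ (2 ℕ.^ suc r) → x <exp fromℕ (suc r)
  <2^⇒<exp r {x} x<2^r =
    r , subst (0ℚ <_) (sym (compoundBase≡2 r)) (fromℕ-mono-< {0} {2} ℕ.z<s) ,
    subst (x <_) (sym (compound≡2^ r)) x<2^r

  -- Two uses of 2^v ≤ e^v: the first gives log n < r + 1, the second log log n < u + 1.
  loglog< : ∀ n r u → n ℕ.< 2 ℕ.^ suc r → suc r ℕ.< 2 ℕ.^ suc u →
            Upper (log (log (fromℚ (fromℕ n)))) (fromℕ (suc u))
  loglog< n r u n<2^r r<2^u =
    -- The inner witness has to lie strictly above n and strictly below 2^(r+1), so density supplies
    -- `s`.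
    let s , n<s , s<2^r = <-dense (fromℕ-mono-< {n} {2 ℕ.^ suc r} n<2^r) in
    fromℕ (suc r) , (s , n<s , <2^⇒<exp r {s} s<2^r) ,
    <2^⇒<exp u {fromℕ (suc r)} (fromℕ-mono-< {suc r} {2 ℕ.^ suc u} r<2^u)

  -- The upper bound u + 1 of log log n witnesses the quotient cut: any q below e - a is below f, so
  -- q (u + 1) < f (u + 1) ≤ K n.
  ≤-÷loglog : ∀ K n e a f r u → e ℕ.≤ a ℕ.+ f → f ℕ.* suc u ℕ.≤ K ℕ.* n →
              n ℕ.< 2 ℕ.^ suc r → suc r ℕ.< 2 ℕ.^ suc u →
              fromℚ (fromℤ (ℤ.+ e ℤ.- ℤ.+ a)) ≤ᶜ
                (fromℕ K * fromℕ n) ÷ᶜ log (log (fromℚ (fromℕ n)))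
  ≤-÷loglog K n e a f r u e≤a+f fu≤Kn n<2^r r<2^u {q} q<d =
    fromℕ (suc u) , loglog< n r u n<2^r r<2^u , q*u<Kn
    where
    open ≤-Reasoning

    u>0 : Positive (fromℕ (suc u))
    u>0 = positive (fromℕ-mono-< {0} {suc u} ℕ.z<s)

    d≤f : ℤ.+ e ℤ.- ℤ.+ a ℤ.≤ ℤ.+ f
    d≤f = ℤ.≤-trans (ℤ.+-monoˡ-≤ (ℤ.- ℤ.+ a) (ℤ.+≤+ e≤a+f))
      (ℤ.≤-reflexive (trans (cong (λ z → z ℤ.- ℤ.+ a) (ℤ.+-comm (ℤ.+ a) (ℤ.+ f)))
        (trans (ℤ.+-assoc (ℤ.+ f) (ℤ.+ a) (ℤ.- ℤ.+ a))
          (trans (cong (ℤ._+_ (ℤ.+ f)) (ℤ.+-inverseʳ (ℤ.+ a))) (ℤ.+-identityʳ (ℤ.+ f))))))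

    q*u<Kn : q * fromℕ (suc u) < fromℕ K * fromℕ n
    q*u<Kn = begin-strict
      q * fromℕ (suc u)         <⟨ *-monoˡ-<-pos (fromℕ (suc u)) {{u>0}} (<-≤-trans q<d (fromℤ-mono-≤ d≤f)) ⟩
      fromℕ f * fromℕ (suc u)   ≡⟨ fromℕ-* f (suc u) ⟨
      fromℕ (f ℕ.* suc u)       ≤⟨ fromℤ-mono-≤ (ℤ.+≤+ fu≤Kn) ⟩
      fromℕ (K ℕ.* n)           ≡⟨ fromℕ-* K n ⟩
      fromℕ K * fromℕ n         ∎

-- The set A: its coprime subsets, its element outside E, and its size.

module Construction where

  open Summation
  open Sieve using (coprimeTo)
  open import Data.Empty using (⊥-elim)
  open import Data.Fin using (Fin; zero; suc; toℕ; fromℕ<)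
  open import Data.Fin.Properties
    using (any?; pigeonhole; suc-injective; toℕ-injective; toℕ-fromℕ<; toℕ-fromℕ; toℕ-inject₁; toℕ<n; <⇒≢)
  open import Data.Fin.Relation.Unary.Top using (view; ‵fromℕ; ‵inject₁)
  open import Data.Fin.Subset using (Subset; inside; outside; _∈_; _⊈_; ∣_∣)
  open import Data.Nat as ℕ using (ℕ; zero; suc; _+_; _*_; _≤_; NonZero)
  open import Data.Nat.Coprimality using (Coprime; coprime?) renaming (sym to coprime-sym)
  open import Data.Nat.Divisibility
  open import Data.Nat.Primality using (Prime; prime⇒nonZero; prime⇒nonTrivial)
  import Data.Nat.Properties as ℕ
  open import Data.Product using (∃-syntax; _×_; _,_; proj₁; proj₂)
  open import Data.Sum using (_⊎_; inj₁; inj₂)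
  open import Data.Vec using (_∷_; tabulate; here; there)
  open import Data.Vec.Properties using (lookup⇒[]=; []=⇒lookup; lookup∘tabulate)
  open import Function using (_∘_)
  open import Relation.Binary.PropositionalEquality
  open import Relation.Nullary using (¬_; Dec; does; yes; no; contradiction; ¬?)
  open import Relation.Nullary.Decidable using (_×-dec_; _⊎-dec_; dec-true)

  nthPrime-prime : ∀ i → Prime (nthPrime (suc i))
  nthPrime-prime i = proj₁ (proj₂ (proj₂ (nextPrime (nthPrime i))))

  nthPrime∤1 : ∀ i → ¬ (nthPrime (suc i) ∣ 1)
  nthPrime∤1 i p∣1 =
    ℕ.nonTrivial⇒≢1 {{prime⇒nonTrivial (nthPrime-prime i)}} (∣1⇒≡1 p∣1)

  primorial : ℕ → ℕ
  primorial k = ∏ k (nthPrime ∘ suc)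

  primorial≢0 : ∀ k → NonZero (primorial k)
  primorial≢0 k = ∏≢0 k (prime⇒nonZero ∘ nthPrime-prime)

  module _ {n} {P : ℕ → Set} (P? : ∀ x → Dec (P x)) {i : Fin n} where

    ∈-tabulate⁺ : P (toℕ i) → i ∈ tabulate (λ i → does (P? (toℕ i)))
    ∈-tabulate⁺ p =
      lookup⇒[]= i _ (trans (lookup∘tabulate _ i) (dec-true (P? (toℕ i)) p))

    ∈-tabulate⁻ : i ∈ tabulate (λ i → does (P? (toℕ i))) → P (toℕ i)
    ∈-tabulate⁻ i∈ with P? (toℕ i) | trans (sym (lookup∘tabulate _ i)) ([]=⇒lookup i∈)
    ... | yes p | _  = p
    ... | no  _ | ()

  -- Enumerates `B` by `Fin ∣ B ∣`, the form to which `pigeonhole` applies.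
  element : ∀ {n} (B : Subset n) → Fin ∣ B ∣ → Fin n
  element (inside  ∷ B) zero    = zero
  element (inside  ∷ B) (suc i) = suc (element B i)
  element (outside ∷ B) i       = suc (element B i)

  element-∈ : ∀ {n} (B : Subset n) i → element B i ∈ B
  element-∈ (inside  ∷ B) zero    = here
  element-∈ (inside  ∷ B) (suc i) = there (element-∈ B i)
  element-∈ (outside ∷ B) i       = there (element-∈ B i)

  element-injective : ∀ {n} (B : Subset n) {i j} → element B i ≡ element B j → i ≡ j
  element-injective (inside  ∷ B) {zero}  {zero}  eq = refl
  element-injective (inside  ∷ B) {suc i} {suc j} eq =
    cong suc (element-injective B (suc-injective eq))
  element-injective (outside ∷ B) eq = element-injective B (suc-injective eq)

  module _ (k m : ℕ) where

    -- Every class is free of coprime pairs; class zero belongs to p_{k+1}.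
    Class : Fin (suc k) → ℕ → Set
    Class zero    x = (nthPrime (suc k) ∣ x × ¬ Coprime x m) ⊎ x ≡ m
    Class (suc c) x = nthPrime (val c) ∣ x

    class? : ∀ c x → Dec (Class c x)
    class? zero    x = ((nthPrime (suc k) ∣? x) ×-dec ¬? (coprime? x m)) ⊎-dec (x ℕ.≟ m)
    class? (suc c) x = nthPrime (val c) ∣? x

    member? : ∀ x → Dec (∃[ c ] Class c x)
    member? x = any? (λ c → class? c x)

    A : ∀ n → Subset n
    A n = tabulate (λ i → does (member? (val i)))

    -- Two multiples of one prime are never coprime. In class zero a mixed pair is excluded by the
    -- condition of not being coprime to `m`, which leaves only the pair of `m` with itself.
    class-unique : ∀ c {x y} → Class c x → Class c y → Coprime x y → x ≡ y
    class-unique zero (inj₁ (p∣x , _)) (inj₁ (p∣y , _)) coprime =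
      contradiction (∣-reflexive (coprime (p∣x , p∣y))) (nthPrime∤1 k)
    class-unique zero (inj₁ (_ , ¬coprime)) (inj₂ refl) coprime = ⊥-elim (¬coprime coprime)
    class-unique zero (inj₂ refl) (inj₁ (_ , ¬coprime)) coprime =
      ⊥-elim (¬coprime (coprime-sym coprime))
    class-unique zero (inj₂ x≡m) (inj₂ y≡m) _ = trans x≡m (sym y≡m)
    class-unique (suc c) p∣x p∣y coprime =
      contradiction (∣-reflexive (coprime (p∣x , p∣y))) (nthPrime∤1 (toℕ c))

    -- Here `suc k` is the k of the theorem: among k + 2 elements two share one of the k + 1
    -- classes, against `class-unique`.
    A∈C : ∀ n → C (suc k) n (A n)
    A∈C n (B , B⊆A , ∣B∣≡2+k , coprime) =
      let i , j , i<j , same = pigeonhole (ℕ.≤-reflexive (sym ∣B∣≡2+k)) (proj₁ ∘ class)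
          eᵢ≢eⱼ = <⇒≢ i<j ∘ element-injective B
      in eᵢ≢eⱼ (toℕ-injective (ℕ.suc-injective (class-unique (proj₁ (class j))
           (subst (λ c → Class c (val (element B i))) same (proj₂ (class i)))
           (proj₂ (class j))
           (coprime (element-∈ B i) (element-∈ B j) eᵢ≢eⱼ))))
      where
      class : ∀ i → ∃[ c ] Class c (val (element B i))
      class i = ∈-tabulate⁻ (member? ∘ suc) (B⊆A (element-∈ B i))

    -- The element `m` is in `A n`; a prime among p₁, ..., p_{k+1} dividing m = 1 + wQ would divide
    -- Q too, hence 1.
    A⊈E : ∀ {n w} → m ≡ suc (w * primorial (suc k)) → m ≤ n → A n ⊈ E (suc k) n
    A⊈E {n} {w} refl m≤n A⊆E = nthPrime∤1 (toℕ c)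
      (∣m+n∣m⇒∣n (subst (p ∣_) (trans val≡m (ℕ.+-comm 1 _)) p∣val)
                 (∣n⇒∣m*n w (∣∏ (nthPrime ∘ suc) (toℕ<n c))))
      where
      -- As m = suc (wQ), `m≤n` reads as wQ < n; this index is m - 1 and stands for `m`.
      i : Fin n
      i = fromℕ< m≤n

      val≡m : val i ≡ m
      val≡m = cong suc (toℕ-fromℕ< m≤n)

      i∈E : DivisibleByFirst (suc k) (val i)
      i∈E = ∈-tabulate⁻ (divisibleByFirst? (suc k) ∘ suc)
        (A⊆E (∈-tabulate⁺ (member? ∘ suc) (zero , inj₂ val≡m)))

      c = proj₁ i∈E
      p∣val = proj₂ i∈E
      p = nthPrime (val c)

    -- Only multiples of the last prime p_{k+1} can be missing. The view separates its top index,
    -- which goes to class zero; every other index `j` goes to class `suc j`.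
    divisible⇒member : ∀ {x} → DivisibleByFirst (suc k) x → (∃[ c ] Class c x) ⊎ Coprime x m
    divisible⇒member {x} (c , p∣x) with view c
    ... | ‵inject₁ j = inj₁ (suc j , subst (λ i → nthPrime (suc i) ∣ x) (toℕ-inject₁ j) p∣x)
    ... | ‵fromℕ with coprime? x m
    ...   | yes coprime = inj₂ coprime
    ...   | no ¬coprime =
      inj₁ (zero , inj₁ (subst (λ i → nthPrime (suc i) ∣ x) (toℕ-fromℕ k) p∣x , ¬coprime))

    ∣E∣≤ : ∀ n → ∣ E (suc k) n ∣ ≤ ∣ A n ∣ + ∑ n (coprimeTo m ∘ suc)
    ∣E∣≤ n = begin
      ∣ E (suc k) n ∣                                      ≡⟨ ∣tabulate∣ n (divisibleByFirst? (suc k) ∘ suc) ⟩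
      ∑ n (λ x → 𝟙 (divisibleByFirst? (suc k) (suc x)))    ≤⟨ ∑-mono-≤ n (λ {x} _ → 𝟙-⊎ (divisibleByFirst? (suc k) (suc x))
                                                                (member? (suc x)) (coprime? (suc x) m) divisible⇒member) ⟩
      ∑ n (λ x → 𝟙 (member? (suc x)) + coprimeTo m (suc x)) ≡⟨ ∑-distrib-+ n (𝟙 ∘ member? ∘ suc) (coprimeTo m ∘ suc) ⟩
      ∑ n (𝟙 ∘ member? ∘ suc) + ∑ n (coprimeTo m ∘ suc)    ≡⟨ cong (_+ ∑ n (coprimeTo m ∘ suc)) (∣tabulate∣ n (member? ∘ suc)) ⟨
      ∣ A n ∣ + ∑ n (coprimeTo m ∘ suc)                    ∎
      where open ℕ.≤-Reasoning

-- The choice of t for given n, and the constants.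

open import Data.Nat using (ℕ; _≥_)
open import Data.Integer using (+_; _-_)
open import Data.Rational using (ℚ; 0ℚ; _<_; _*_)
open import Data.Fin.Subset using (Subset; _⊈_; ∣_∣)
open import Data.Product using (Σ; ∃-syntax; _×_)

open import Data.Nat as ℕ using (suc)
import Data.Nat.Properties as ℕ
open import Data.Product using (_,_)
open import Function using (_∘_)
open import Relation.Binary.PropositionalEquality using (sym; subst)
open Summation using (∑)
open Sieve
open Construction
open LogLog

theorem4 : ∀ (k : ℕ) → k ≥ 1 →
    ∃[ K ] 0ℚ < K × (∃[ nₖ ] (∀ (n : ℕ) → n ≥ nₖ →
    Σ (Subset n) λ A →
    C k n A × A ⊈ E k n ×
    fromℚ (fromℤ (+ ∣ E k n ∣ - + ∣ A ∣)) ≤ᶜ (K * fromℕ n) ÷ᶜ log (log (fromℚ (fromℕ n)))))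
-- K is the constant of `lost≤`; the threshold `tower Q` allows a choice of t ≥ Q, as `modulus≤`
-- requires.
theorem4 (suc k) _ = fromℕ (24 ℕ.* Q) , fromℕ-mono-< {0} {24 ℕ.* Q} 0<24Q , tower Q , construct
  where
  Q = primorial (suc k)
  instance Q≢0 = primorial≢0 (suc k)

  0<24Q : 0 ℕ.< 24 ℕ.* Q
  0<24Q = ℕ.*-mono-≤ {1} {24} (ℕ.s≤s ℕ.z≤n) (ℕ.>-nonZero⁻¹ Q)

  tower : ℕ → ℕ
  tower t = 2 ℕ.^ (2 ℕ.^ (1 ℕ.+ t ℕ.+ t))

  t<tower : ∀ t → t ℕ.< tower t
  t<tower t = ℕ.<-trans (ℕ.s≤s (ℕ.m≤m+n t t)) (ℕ.<-trans (n<2^n _) (n<2^n _))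

  construct : ∀ n → n ≥ tower Q → Σ (Subset n) λ A → C (suc k) n A × A ⊈ E (suc k) n ×
    fromℚ (fromℤ (+ ∣ E (suc k) n ∣ - + ∣ A ∣)) ≤ᶜ
      (fromℕ (24 ℕ.* Q) * fromℕ n) ÷ᶜ log (log (fromℚ (fromℕ n)))
  construct n n≥ =
    -- `tower t` is the bound of `modulus≤`, so tower t ≤ n gives m ≤ n, while n < tower (t + 1)
    -- bounds log log n.
    let t , Q≤t , tower≤n , n<tower = bracket tower t<tower n≥
        m = modulus Q t
        m≤n = ℕ.≤-trans (modulus≤ Q Q≤t) tower≤n
        w , m≡1+wQ = modulus≡1 Q t
        -- With e = 2t + 3, tower (t + 1) is 2^(2^e), and `r` is chosen so that r + 1 = 2^e. The
        -- strict inequality in `loglog<` raises the final bound to 2t + 4, the factor in `lost≤`.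
        e = 1 ℕ.+ suc t ℕ.+ suc t
        r = ℕ.pred (2 ℕ.^ e)
        1+r≡2^e = ℕ.suc-pred (2 ℕ.^ e) {{ℕ.m^n≢0 2 e}}
        e<4+2t = ℕ.s≤s (ℕ.s≤s (ℕ.≤-reflexive (ℕ.+-suc (suc t) t)))
    in A k m n , A∈C k m n , A⊈E k m {w = w} m≡1+wQ m≤n ,
       ≤-÷loglog (24 ℕ.* Q) n (∣ E (suc k) n ∣) (∣ A k m n ∣) (∑ n (coprimeTo m ∘ suc)) r (3 ℕ.+ t ℕ.+ t)
         (∣E∣≤ k m n)
         (lost≤ Q (ℕ.≤-trans (ℕ.>-nonZero⁻¹ Q) Q≤t) m≤n)
         (subst (λ x → n ℕ.< 2 ℕ.^ x) (sym 1+r≡2^e) n<tower)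
         (subst (ℕ._< 2 ℕ.^ (4 ℕ.+ t ℕ.+ t)) (sym 1+r≡2^e)
           (ℕ.^-monoʳ-< 2 ℕ.≤-refl e<4+2t))
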